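{- There exists an absolute constant $c>0$ such that for all positive integers $d$, $$\operatorname{herdisc}(\mathcal{S}^d) \;\geq\; c\, 2^{d/16},$$ where $\mathcal{S}^d$ is the set system of all subcubes of the boolean cube $\{0,1\}^d$.
   Context: For a positive integer $d$, the set system $\mathcal{S}^d = \{S_v\}_{v \in \{0,1,*\}^d}$ on the ground set $\{0,1\}^d$ is defined by $$S_v = \{u \in \{0,1\}^d : \text{for all } i,\ v_i \neq * \Rightarrow u_i = v_i\}.$$ For a finite set system $\mathcal{S} = \{S_1,\ldots,S_m\}$ of subsets of a finite ground set $U$, and $W \subseteq U$, the restriction is $\mathcal{S}|_W = \{S_1 \cap W, \ldots, S_m \cap W\}$, a set system on the ground set $W$. The discrepancy and hereditary discrepancy are $$\operatorname{disc}(\mathcal{S}) = \min_{f: U \to \{ -1,+1\}} \max_{j \in \{1,\ldots,m\}} \Bigl|\sum_{i \in S_j} f(i)\Bigr|, \qquad \operatorname{herdisc}(\mathcal{S}) = \max_{W \subseteq U} \operatorname{disc}(\mathcal{S}|_W).$$ -}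

module Defs where

open import Data.Bool using (Bool; true; false; if_then_else_)
import Data.Bool.Properties as Bool
import Data.Fin.Properties as Fin
open import Data.Fin.Subset using (Subset; inside; outside; ∣_∣)
open import Data.Integer as ℤ using (ℤ; 0ℤ; _◃_)
import Data.Integer.Properties as ℤ
open import Data.List as List using (List)
open import Data.List.Extrema.Nat using (min; max)
open import Data.Maybe using (Maybe; just; nothing)
import Data.Maybe.Properties as Maybe
open import Data.Nat using (ℕ; zero; suc; _^_)
open import Data.Product using (uncurry)
open import Data.Rational as ℚ using (ℚ)
open import Data.Sign using (Sign)
open import Data.Vec as Vec using (Vec; []; _∷_; lookup; allPairs; toList)
open import Data.Vec.Membership.Propositional using (_∈_)
open import Data.Vec.Membership.Propositional.Properties using (∈-map⁺; ∈-allPairs⁺)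
open import Data.Vec.Relation.Unary.Any using (here)
open import Relation.Binary.PropositionalEquality using (_≡_; _≢_; refl)
open import Relation.Nullary using (Dec; does; ¬?; _→-dec_)

open import Algebra.Properties.CommutativeMonoid.Sum ℤ.+-0-commutativeMonoid using (sum-syntax)

-- If as lists the k elements of A without repetition, then words as n lists
-- the k ^ n elements of Vec A n without repetition (see ∈-words).
words : {A : Set} {k : ℕ} → Vec A k → (n : ℕ) → Vec (Vec A n) (k ^ n)
words as zero    = [] ∷ []
words as (suc n) = Vec.map (uncurry _∷_) (allPairs as (words as n))

∈-words : {A : Set} {k : ℕ} {as : Vec A k} → (∀ a → a ∈ as) →
          ∀ {n} (w : Vec A n) → w ∈ words as n
∈-words all []      = here refl
∈-words all (a ∷ w) = ∈-map⁺ (uncurry _∷_) (∈-allPairs⁺ (all a) (∈-words all w))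

-- A finite family of subsets of a ground set with n points.
SetSystem : ℕ → Set
SetSystem n = List (Subset n)

-- S ∩ W as a subset of W, whose points are renumbered increasingly by Fin ∣ W ∣.
infix 6 _∩∣_
_∩∣_ : ∀ {n} → Subset n → (W : Subset n) → Subset ∣ W ∣
[]      ∩∣ []            = []
(s ∷ S) ∩∣ (inside ∷ W)  = s ∷ (S ∩∣ W)
(s ∷ S) ∩∣ (outside ∷ W) = S ∩∣ W

infix 6 _∣∣_
_∣∣_ : ∀ {n} → SetSystem n → (W : Subset n) → SetSystem ∣ W ∣
𝒮 ∣∣ W = List.map (_∩∣ W) 𝒮

Coloring : ℕ → Set
Coloring n = Vec Sign n

colorings : (n : ℕ) → List (Coloring n)
colorings n = toList (words (Sign.+ ∷ Sign.- ∷ []) n)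

subsets : (n : ℕ) → List (Subset n)
subsets n = toList (words (inside ∷ outside ∷ []) n)

sumOver : ∀ {n} → Subset n → Coloring n → ℤ
sumOver {n} S f = ∑[ i < n ] (if lookup S i then lookup f i ◃ 1 else 0ℤ)

maxImbalance : ∀ {n} → SetSystem n → Coloring n → ℕ
maxImbalance 𝒮 f = max 0 (List.map (λ S → ℤ.∣ sumOver S f ∣) 𝒮)

-- The first argument of min is the value of one of the colorings in the list,
-- so it does not change the minimum; likewise max 0 on a nonempty list of naturals.
disc : ∀ {n} → SetSystem n → ℕ
disc {n} 𝒮 = min (maxImbalance 𝒮 (Vec.replicate n Sign.+))
                 (List.map (maxImbalance 𝒮) (colorings n))

herdisc : ∀ {n} → SetSystem n → ℕ
herdisc {n} 𝒮 = max 0 (List.map (λ W → disc (𝒮 ∣∣ W)) (subsets n))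

Vertex : ℕ → Set
Vertex d = Vec Bool d

-- Words over {0,1,*}, with nothing in the role of *.
Pattern : ℕ → Set
Pattern d = Vec (Maybe Bool) d

infix 4 _∈S_
_∈S_ : ∀ {d} → Vertex d → Pattern d → Set
u ∈S v = ∀ i → lookup v i ≢ nothing → just (lookup u i) ≡ lookup v i

infix 4 _∈S?_
_∈S?_ : ∀ {d} (u : Vertex d) (v : Pattern d) → Dec (u ∈S v)
u ∈S? v = Fin.all? λ i →
  ¬? (Maybe.≡-dec Bool._≟_ (lookup v i) nothing)
    →-dec Maybe.≡-dec Bool._≟_ (just (lookup u i)) (lookup v i)

-- Fixes the numbering of the ground set {0,1}^d by Fin (2 ^ d).
vertices : (d : ℕ) → Vec (Vertex d) (2 ^ d)
vertices = words (false ∷ true ∷ [])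

patterns : (d : ℕ) → List (Pattern d)
patterns d = toList (words (just false ∷ just true ∷ nothing ∷ []) d)

subcube : ∀ {d} → Pattern d → Subset (2 ^ d)
subcube {d} v = Vec.map (λ u → does (u ∈S? v)) (vertices d)

subcubes : (d : ℕ) → SetSystem (2 ^ d)
subcubes d = List.map subcube (patterns d)

fromℕ : ℕ → ℚ
fromℕ n = ℤ.+ n ℚ./ 1

-- Let the ground set W consist of the words built from t = ⌊d/3⌋ blocks, each a
-- vertex of the regular tetrahedron in the 3-cube, padded with zeros. In each
-- block use only the 6 facets of the 3-cube as sets; these induce the 6 edges of
-- the tetrahedron. Since Σ_{i<j} (x_i + x_j)² = 2 Σ x_i² + (Σ x_i)², iterating over
-- the blocks shows that the squared imbalances of a ±1 coloring x of W over the
-- 6^t sets add up to at least 2^t Σ x² = 8^t. Hence some set has squared imbalance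
-- at least (8/6)^t, and (8/6)^8 ≥ 8 turns this into H^16 ≥ 8^t ≥ 2^d / 4.
module Submission where

open import Defs
open import Data.Nat as ℕ using (ℕ; NonZero)
open import Data.Product using (∃; _×_)
open import Data.Rational using (ℚ; Positive; _*_; _≥_; +-*-rawSemiring)
open import Algebra.Definitions.RawSemiring +-*-rawSemiring using (_^_)

open import Algebra.Bundles using (CommutativeRing)
open import Data.Bool using (Bool; true; false; if_then_else_; _∧_; _xor_; not)
open import Data.Fin using (Fin; zero; suc)
open import Data.Fin.Patterns using (0F; 1F; 2F; 3F; 4F; 5F)
open import Data.Fin.Subset using (Subset; inside; outside; ∣_∣)
open import Data.Integer as ℤ using (ℤ; +_; 0ℤ; _◃_)
import Data.Integer.Properties as ℤ
open import Data.Integer.Tactic.RingSolver using (solve-∀)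
open import Data.List.Extrema.Nat using (argmin-all; xs≤max)
import Data.List.Membership.Propositional as List
open import Data.List.Membership.Propositional.Properties using (∈-map⁺)
import Data.List.Relation.Unary.All as All
open import Data.List.Relation.Unary.All.Properties using (map⁺)
open import Data.Maybe using (Maybe; just; nothing)
import Data.Nat.Properties as ℕ
import Algebra.Properties.CommutativeSemigroup ℕ.*-commutativeSemigroup as ℕ*
open import Data.Nat using (zero; suc)
open import Data.Product using (_,_; uncurry)
open import Data.Rational as ℚ using (½; 1ℚ; toℚᵘ)
import Data.Rational.Properties as ℚ
import Data.Rational.Unnormalised as ℚᵘ
import Data.Rational.Unnormalised.Properties as ℚᵘ
open import Data.Sign using (Sign)
open import Data.Unit using (tt)
open import Data.Vec as Vec using (Vec; []; _∷_; _++_; lookup)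
open import Data.Vec.Membership.Propositional using (_∈_)
open import Data.Vec.Membership.Propositional.Properties using (∈-toList⁺)
open import Data.Vec.Properties using (map-++; map-∘; ∷-injective; take++drop≡id)
open import Data.Vec.Relation.Unary.Any using (here; there)
open import Function using (_∘_; id)
open import Relation.Binary.PropositionalEquality
  using (_≡_; _≗_; refl; sym; trans; cong; cong₂; subst; subst₂; module ≡-Reasoning)
open import Relation.Nullary using (does)
open import Relation.Nullary.Decidable using (toWitness)

open import Algebra.Properties.CommutativeMonoid.Sum ℤ.+-0-commutativeMonoid
  using (sum-syntax; sum-cong-≗; ∑-distrib-+)
open import Algebra.Properties.Semiring.Sum (CommutativeRing.semiring ℤ.+-*-commutativeRing)
  using (*-distribˡ-sum)

private variable
  A : Set
  k n d : ℕ

-- Finite sums and squares of integers.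

∑-mono : {f g : Fin n → ℤ} → (∀ i → f i ℤ.≤ g i) → ∑[ i < n ] f i ℤ.≤ ∑[ i < n ] g i
∑-mono {zero}  f≤g = ℤ.≤-refl
∑-mono {suc n} f≤g = ℤ.+-mono-≤ (f≤g zero) (∑-mono (f≤g ∘ suc))

∑-const : ∀ n (c : ℤ) → ∑[ i < n ] c ≡ + n ℤ.* c
∑-const zero    c = sym (ℤ.*-zeroˡ c)
∑-const (suc n) c = trans (cong (ℤ._+_ c) (∑-const n c)) (sym (ℤ.suc-* (+ n) c))

square : ℤ → ℤ
square a = a ℤ.* a

0≤square : ∀ a → 0ℤ ℤ.≤ square a
0≤square (+ n)      = subst (0ℤ ℤ.≤_) (ℤ.pos-* n n) (ℤ.+≤+ ℕ.z≤n)
0≤square ℤ.-[1+ n ] = ℤ.+≤+ ℕ.z≤n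

square-mono : ∀ a {M} → ℤ.∣ a ∣ ℕ.≤ M → square a ℤ.≤ + (M ℕ.* M)
square-mono a {M} a≤M = subst (ℤ._≤ _) (abs² a) (ℤ.+≤+ (ℕ.*-mono-≤ a≤M a≤M))
  where
  abs² : ∀ a → + (ℤ.∣ a ∣ ℕ.* ℤ.∣ a ∣) ≡ square a
  abs² (+ n)      = ℤ.pos-* n n
  abs² ℤ.-[1+ n ] = refl

square-sign : ∀ s → square (s ◃ 1) ≡ + 1
square-sign Sign.+ = refl
square-sign Sign.- = refl

-- Sums over words made of blocks of length three.

blocks : ℕ → ℕ
blocks (suc (suc (suc d))) = suc (blocks d)
blocks _                   = 0

-- The sum of g over the words that are concatenations of blocks d of the
-- words hs of length 3, followed by at most two letters z.
blockSum : Vec (Vec A 3) k → A → ∀ d → (Vec A d → ℤ) → ℤ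
blockSum {k = k} hs z (suc (suc (suc d))) g =
  ∑[ i < k ] blockSum hs z d (λ w → g (lookup hs i ++ w))
blockSum hs z 2 g = g (z ∷ z ∷ [])
blockSum hs z 1 g = g (z ∷ [])
blockSum hs z 0 g = g []

module _ (hs : Vec (Vec A 3) k) (z : A) where

  blockSum-cong : ∀ d {f g} → f ≗ g → blockSum hs z d f ≡ blockSum hs z d g
  blockSum-cong 0 f≗g = f≗g _
  blockSum-cong 1 f≗g = f≗g _
  blockSum-cong 2 f≗g = f≗g _
  blockSum-cong (suc (suc (suc d))) f≗g = sum-cong-≗ {k} λ i → blockSum-cong d λ w → f≗g (lookup hs i ++ w)

  blockSum-mono : ∀ d {f g} → (∀ w → f w ℤ.≤ g w) → blockSum hs z d f ℤ.≤ blockSum hs z d g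
  blockSum-mono 0 f≤g = f≤g _
  blockSum-mono 1 f≤g = f≤g _
  blockSum-mono 2 f≤g = f≤g _
  blockSum-mono (suc (suc (suc d))) f≤g = ∑-mono {k} λ i → blockSum-mono d λ w → f≤g (lookup hs i ++ w)

  blockSum-const : ∀ d c → blockSum hs z d (λ _ → c) ≡ + (k ℕ.^ blocks d) ℤ.* c
  blockSum-const 0 c = sym (ℤ.*-identityˡ c)
  blockSum-const 1 c = sym (ℤ.*-identityˡ c)
  blockSum-const 2 c = sym (ℤ.*-identityˡ c)
  blockSum-const (suc (suc (suc d))) c = begin
    ∑[ i < k ] blockSum hs z d (λ _ → c)      ≡⟨ ∑-const k _ ⟩
    + k ℤ.* blockSum hs z d (λ _ → c)         ≡⟨ cong (+ k ℤ.*_) (blockSum-const d c) ⟩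
    + k ℤ.* (+ (k ℕ.^ blocks d) ℤ.* c)        ≡⟨ ℤ.*-assoc (+ k) _ c ⟨
    + k ℤ.* + (k ℕ.^ blocks d) ℤ.* c          ≡⟨ cong (ℤ._* c) (ℤ.pos-* k _) ⟨
    + (k ℕ.* k ℕ.^ blocks d) ℤ.* c            ∎
    where open ≡-Reasoning

  blockSum-zero : ∀ d → blockSum hs z d (λ _ → 0ℤ) ≡ 0ℤ
  blockSum-zero d = trans (blockSum-const d 0ℤ) (ℤ.*-zeroʳ (+ (k ℕ.^ blocks d)))

  blockSum-+ : ∀ d f g → blockSum hs z d (λ w → f w ℤ.+ g w) ≡ blockSum hs z d f ℤ.+ blockSum hs z d g
  blockSum-+ 0 f g = refl
  blockSum-+ 1 f g = refl
  blockSum-+ 2 f g = refl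
  blockSum-+ (suc (suc (suc d))) f g =
    trans (sum-cong-≗ {k} λ i → blockSum-+ d (λ w → f (lookup hs i ++ w)) (λ w → g (lookup hs i ++ w)))
          (∑-distrib-+ {k} _ _)

  blockSum-∑ : ∀ d (g : Fin n → Vec A d → ℤ) →
               blockSum hs z d (λ w → ∑[ i < n ] g i w) ≡ ∑[ i < n ] blockSum hs z d (g i)
  blockSum-∑ {n = zero}  d g = blockSum-zero d
  blockSum-∑ {n = suc n} d g =
    trans (blockSum-+ d (g zero) _) (cong (ℤ._+_ (blockSum hs z d (g zero))) (blockSum-∑ d (g ∘ suc)))

  blockSum-* : ∀ d c g → blockSum hs z d (λ w → c ℤ.* g w) ≡ c ℤ.* blockSum hs z d g
  blockSum-* 0 c g = refl
  blockSum-* 1 c g = refl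
  blockSum-* 2 c g = refl
  blockSum-* (suc (suc (suc d))) c g =
    trans (sum-cong-≗ {k} λ i → blockSum-* d c λ w → g (lookup hs i ++ w)) (sym (*-distribˡ-sum {k} c _))

  -- Used with `b` the membership test on the first block: it is constant in the tail `w`, so it
  -- comes out of the sum.
  blockSum-if : ∀ d b (f : Vec A d → ℤ) {p : Vec A d → Bool} →
                blockSum hs z d (λ w → if b ∧ p w then f w else 0ℤ) ≡
                (if b then blockSum hs z d (λ w → if p w then f w else 0ℤ) else 0ℤ)
  blockSum-if d true  f = refl
  blockSum-if d false f = blockSum-zero d

-- The tetrahedron in the 3-cube.

tetrahedron : Vec (Vertex 3) 4
tetrahedron = (false ∷ false ∷ false ∷ [])
            ∷ (false ∷ true  ∷ true  ∷ [])
            ∷ (true  ∷ false ∷ true  ∷ [])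
            ∷ (true  ∷ true  ∷ false ∷ []) ∷ []

facets : Vec (Pattern 3) 6
facets = (just false ∷ nothing ∷ nothing ∷ [])
       ∷ (just true  ∷ nothing ∷ nothing ∷ [])
       ∷ (nothing ∷ just false ∷ nothing ∷ [])
       ∷ (nothing ∷ just true  ∷ nothing ∷ [])
       ∷ (nothing ∷ nothing ∷ just false ∷ [])
       ∷ (nothing ∷ nothing ∷ just true  ∷ []) ∷ []

-- The facets of the 3-cube cut out exactly the six edges of the tetrahedron;
-- edge i joins the vertices end₁ i and end₂ i.
end₁ end₂ : Fin 6 → Fin 4
end₁ = lookup (0F ∷ 2F ∷ 0F ∷ 1F ∷ 0F ∷ 1F ∷ [])
end₂ = lookup (1F ∷ 3F ∷ 2F ∷ 3F ∷ 3F ∷ 2F ∷ [])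

-- Each vertex has degree three and each pair of vertices is an edge, so the right side exceeds the
-- left by the square of the total.
edges-square : (x : Fin 4 → ℤ) →
  + 2 ℤ.* ∑[ j < 4 ] square (x j) ℤ.≤ ∑[ i < 6 ] square (x (end₁ i) ℤ.+ x (end₂ i))
edges-square x = subst₂ ℤ._≤_ (ℤ.+-identityʳ _) (identity (x 0F) (x 1F) (x 2F) (x 3F))
  (ℤ.+-monoʳ-≤ (+ 2 ℤ.* ∑[ j < 4 ] square (x j)) (0≤square (x 0F ℤ.+ x 1F ℤ.+ x 2F ℤ.+ x 3F)))
  where
  -- The trailing zeros come from unfolding the sums; the terms on the right follow the order of
  -- `end₁` and `end₂`.
  identity : ∀ a b c e →
    + 2 ℤ.* (a ℤ.* a ℤ.+ (b ℤ.* b ℤ.+ (c ℤ.* c ℤ.+ (e ℤ.* e ℤ.+ 0ℤ)))) ℤ.+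
      (a ℤ.+ b ℤ.+ c ℤ.+ e) ℤ.* (a ℤ.+ b ℤ.+ c ℤ.+ e) ≡
    (a ℤ.+ b) ℤ.* (a ℤ.+ b) ℤ.+ ((c ℤ.+ e) ℤ.* (c ℤ.+ e) ℤ.+
    ((a ℤ.+ c) ℤ.* (a ℤ.+ c) ℤ.+ ((b ℤ.+ e) ℤ.* (b ℤ.+ e) ℤ.+
    ((a ℤ.+ e) ℤ.* (a ℤ.+ e) ℤ.+ ((b ℤ.+ c) ℤ.* (b ℤ.+ c) ℤ.+ 0ℤ)))))
  identity = solve-∀

-- Imbalances of subcubes on the ground set.

pointSum : ∀ d → (Vertex d → ℤ) → ℤ
pointSum = blockSum tetrahedron false

-- Padding by `nothing` puts no condition on the leftover coordinates, so for `d` below 3 the only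
-- pattern contains the only point.
patternSum : ∀ d → (Pattern d → ℤ) → ℤ
patternSum = blockSum facets nothing

-- The imbalance on the trace of a subcube. Weights are integers, not signs, because the induction
-- adds slices of a coloring.
cubeSum : Pattern d → (Vertex d → ℤ) → ℤ
cubeSum {d} v x = pointSum d λ u → if does (u ∈S? v) then x u else 0ℤ

cubeSum-+ : ∀ (v : Pattern d) x y → cubeSum v (λ u → x u ℤ.+ y u) ≡ cubeSum v x ℤ.+ cubeSum v y
cubeSum-+ {d} v x y =
  trans (blockSum-cong _ _ d λ u → if-+ (does (u ∈S? v))) (blockSum-+ _ _ d _ _)
  where
  if-+ : ∀ b {m n} → (if b then m ℤ.+ n else 0ℤ) ≡ (if b then m else 0ℤ) ℤ.+ (if b then n else 0ℤ)
  if-+ true  = refl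
  if-+ false = refl

-- Membership is tested letter by letter: `nothing` or a match contributes true, and a mismatch
-- makes both sides false.
∈S?-++ : ∀ (t : Vertex n) (p : Pattern n) (u : Vertex d) (v : Pattern d) →
         does ((t ++ u) ∈S? (p ++ v)) ≡ does (t ∈S? p) ∧ does (u ∈S? v)
∈S?-++ []      []      u v = refl
∈S?-++ (b     ∷ t) (nothing    ∷ p) u v = ∈S?-++ t p u v
∈S?-++ (false ∷ t) (just false ∷ p) u v = ∈S?-++ t p u v
∈S?-++ (true  ∷ t) (just true  ∷ p) u v = ∈S?-++ t p u v
∈S?-++ (false ∷ t) (just true  ∷ p) u v = refl
∈S?-++ (true  ∷ t) (just false ∷ p) u v = refl

-- Of the four slices over the first block, the facet keeps the two at the ends of its edge;
-- linearity merges them into one weight on the tail.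
cubeSum-facet : ∀ i (v : Pattern d) (x : Vertex (3 ℕ.+ d) → ℤ) →
  let xₕ j u = x (lookup tetrahedron j ++ u) in
  cubeSum (lookup facets i ++ v) x ≡ cubeSum v (λ u → xₕ (end₁ i) u ℤ.+ xₕ (end₂ i) u)
cubeSum-facet {d} i v x = trans (facet i) (sym (cubeSum-+ v _ _))
  where
  y : Fin 4 → ℤ
  y j = cubeSum v λ u → x (lookup tetrahedron j ++ u)

  incident : Fin 6 → Fin 4 → Bool
  incident i j = does (lookup tetrahedron j ∈S? lookup facets i)

  slice : ∀ i j →
    pointSum d (λ u → if does ((lookup tetrahedron j ++ u) ∈S? (lookup facets i ++ v))
                      then x (lookup tetrahedron j ++ u) else 0ℤ) ≡
    (if incident i j then y j else 0ℤ)
  slice i j = trans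
    (blockSum-cong _ _ d λ u → cong (if_then _ else 0ℤ)
      (∈S?-++ (lookup tetrahedron j) (lookup facets i) u v))
    (blockSum-if _ _ d (incident i j) _)

  -- For a concrete facet the incidence tests compute; the cases differ only in where the zeros
  -- fall.
  edge : ∀ i → ∑[ j < 4 ] (if incident i j then y j else 0ℤ) ≡ y (end₁ i) ℤ.+ y (end₂ i)
  edge 0F = identity (y 0F) (y 1F)
    where
    identity : ∀ a b → a ℤ.+ (b ℤ.+ (0ℤ ℤ.+ (0ℤ ℤ.+ 0ℤ))) ≡ a ℤ.+ b
    identity = solve-∀
  edge 1F = identity (y 2F) (y 3F)
    where
    identity : ∀ a b → 0ℤ ℤ.+ (0ℤ ℤ.+ (a ℤ.+ (b ℤ.+ 0ℤ))) ≡ a ℤ.+ b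
    identity = solve-∀
  edge 2F = identity (y 0F) (y 2F)
    where
    identity : ∀ a b → a ℤ.+ (0ℤ ℤ.+ (b ℤ.+ (0ℤ ℤ.+ 0ℤ))) ≡ a ℤ.+ b
    identity = solve-∀
  edge 3F = identity (y 1F) (y 3F)
    where
    identity : ∀ a b → 0ℤ ℤ.+ (a ℤ.+ (0ℤ ℤ.+ (b ℤ.+ 0ℤ))) ≡ a ℤ.+ b
    identity = solve-∀
  edge 4F = identity (y 0F) (y 3F)
    where
    identity : ∀ a b → a ℤ.+ (0ℤ ℤ.+ (0ℤ ℤ.+ (b ℤ.+ 0ℤ))) ≡ a ℤ.+ b
    identity = solve-∀
  edge 5F = identity (y 1F) (y 2F)
    where
    identity : ∀ a b → 0ℤ ℤ.+ (a ℤ.+ (b ℤ.+ (0ℤ ℤ.+ 0ℤ))) ≡ a ℤ.+ b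
    identity = solve-∀

  facet : ∀ i → cubeSum (lookup facets i ++ v) x ≡ y (end₁ i) ℤ.+ y (end₂ i)
  facet i = trans (sum-cong-≗ (slice i)) (edge i)

-- The lower bound on the sum of squared imbalances.

energy : (Vertex d → ℤ) → ℤ
energy {d} x = patternSum d λ v → square (cubeSum v x)

-- Induction over blocks: the four slices of `x` are traded for six edge sums, each a weight on the
-- tail to which the induction hypothesis applies.
energy-bound : ∀ d (x : Vertex d → ℤ) →
  + (2 ℕ.^ blocks d) ℤ.* pointSum d (square ∘ x) ℤ.≤ energy x
energy-bound 0 x = ℤ.≤-reflexive (ℤ.*-identityˡ _)
energy-bound 1 x = ℤ.≤-reflexive (ℤ.*-identityˡ _)
energy-bound 2 x = ℤ.≤-reflexive (ℤ.*-identityˡ _)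
energy-bound (suc (suc (suc d))) x = begin
  + (2 ℕ.* 2 ℕ.^ t) ℤ.* ∑[ j < 4 ] pointSum d (square ∘ xₕ j)
    ≡⟨ cong (ℤ._* ∑[ j < 4 ] pointSum d (square ∘ xₕ j))
         (trans (ℤ.pos-* 2 (2 ℕ.^ t)) (ℤ.*-comm (+ 2) (+ (2 ℕ.^ t)))) ⟩
  + (2 ℕ.^ t) ℤ.* + 2 ℤ.* ∑[ j < 4 ] pointSum d (square ∘ xₕ j)
    ≡⟨ ℤ.*-assoc (+ (2 ℕ.^ t)) (+ 2) _ ⟩
  + (2 ℕ.^ t) ℤ.* (+ 2 ℤ.* ∑[ j < 4 ] pointSum d (square ∘ xₕ j))
    ≡⟨ cong (λ s → + (2 ℕ.^ t) ℤ.* (+ 2 ℤ.* s)) (blockSum-∑ _ _ d (λ j → square ∘ xₕ j)) ⟨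
  + (2 ℕ.^ t) ℤ.* (+ 2 ℤ.* pointSum d (λ u → ∑[ j < 4 ] square (xₕ j u)))
    ≡⟨ cong (+ (2 ℕ.^ t) ℤ.*_) (blockSum-* _ _ d (+ 2) _) ⟨
  + (2 ℕ.^ t) ℤ.* pointSum d (λ u → + 2 ℤ.* ∑[ j < 4 ] square (xₕ j u))
    -- The first block yields its factor 2 here, separately for every tail `u`.
    ≤⟨ ℤ.*-monoˡ-≤-nonNeg (+ (2 ℕ.^ t)) (blockSum-mono _ _ d λ u → edges-square λ j → xₕ j u) ⟩
  + (2 ℕ.^ t) ℤ.* pointSum d (λ u → ∑[ i < 6 ] square (xₑ i u))
    ≡⟨ cong (+ (2 ℕ.^ t) ℤ.*_) (blockSum-∑ _ _ d (λ i → square ∘ xₑ i)) ⟩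
  + (2 ℕ.^ t) ℤ.* ∑[ i < 6 ] pointSum d (square ∘ xₑ i)
    ≡⟨ *-distribˡ-sum (+ (2 ℕ.^ t)) (λ i → pointSum d (square ∘ xₑ i)) ⟩
  ∑[ i < 6 ] (+ (2 ℕ.^ t) ℤ.* pointSum d (square ∘ xₑ i))
    ≤⟨ ∑-mono {6} (λ i → energy-bound d (xₑ i)) ⟩
  ∑[ i < 6 ] energy (xₑ i)
    ≡⟨ sum-cong-≗ {6} (λ i → blockSum-cong facets nothing d λ v → cong square (cubeSum-facet i v x)) ⟨
  energy x ∎
  where
  open ℤ.≤-Reasoning
  t = blocks d
  xₕ : Fin 4 → Vertex d → ℤ
  xₕ j u = x (lookup tetrahedron j ++ u)
  xₑ : Fin 6 → Vertex d → ℤ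
  xₑ i u = xₕ (end₁ i) u ℤ.+ xₕ (end₂ i) u

^-distribʳ-* : ∀ m n o → (m ℕ.* n) ℕ.^ o ≡ m ℕ.^ o ℕ.* n ℕ.^ o
^-distribʳ-* m n zero    = refl
^-distribʳ-* m n (suc o) = trans (cong (m ℕ.* n ℕ.*_) (^-distribʳ-* m n o))
  (ℕ*.interchange m n (m ℕ.^ o) (n ℕ.^ o))

-- Averaging: the energy is at least `2 ^ t` times the number `4 ^ t` of points, and each of its
-- `6 ^ t` terms is at most the square of `M`.
imbalance-bound : ∀ d (x : Vertex d → Sign) M →
  (∀ (v : Pattern d) → ℤ.∣ cubeSum v (λ u → x u ◃ 1) ∣ ℕ.≤ M) →
  8 ℕ.^ blocks d ℕ.≤ 6 ℕ.^ blocks d ℕ.* (M ℕ.* M)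
imbalance-bound d x M x≤M = ℤ.drop‿+≤+ (begin
  + (8 ℕ.^ t)                                   ≡⟨ cong +_ (^-distribʳ-* 2 4 t) ⟩
  + (2 ℕ.^ t ℕ.* 4 ℕ.^ t)                       ≡⟨ ℤ.pos-* (2 ℕ.^ t) _ ⟩
  + (2 ℕ.^ t) ℤ.* + (4 ℕ.^ t)                   ≡⟨ cong (+ (2 ℕ.^ t) ℤ.*_) ∑x² ⟨
  + (2 ℕ.^ t) ℤ.* pointSum d (λ u → square (x u ◃ 1))  ≤⟨ energy-bound d _ ⟩
  energy (λ u → x u ◃ 1)                        ≤⟨ blockSum-mono _ _ d (λ v → square-mono (cubeSum v _) (x≤M v)) ⟩
  patternSum d (λ _ → + (M ℕ.* M))              ≡⟨ blockSum-const _ _ d _ ⟩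
  + (6 ℕ.^ t) ℤ.* + (M ℕ.* M)                   ≡⟨ ℤ.pos-* (6 ℕ.^ t) _ ⟨
  + (6 ℕ.^ t ℕ.* (M ℕ.* M))                     ∎)
  where
  open ℤ.≤-Reasoning
  t = blocks d
  ∑x² : pointSum d (λ u → square (x u ◃ 1)) ≡ + (4 ℕ.^ t)
  ∑x² = trans (blockSum-cong _ _ d (square-sign ∘ x))
          (trans (blockSum-const _ _ d (+ 1)) (ℤ.*-identityʳ _))

-- Sums over the whole cube and the indicator of the ground set.

vsum : Vec ℤ n → ℤ
vsum = Vec.foldr′ ℤ._+_ 0ℤ

vsum-++ : ∀ {m} (xs : Vec ℤ m) (ys : Vec ℤ n) → vsum (xs ++ ys) ≡ vsum xs ℤ.+ vsum ys
vsum-++ []       ys = sym (ℤ.+-identityˡ _)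
vsum-++ (x ∷ xs) ys = trans (cong (ℤ._+_ x) (vsum-++ xs ys)) (sym (ℤ.+-assoc x _ _))

vsum-map-zero : (us : Vec A n) → vsum (Vec.map (λ _ → 0ℤ) us) ≡ 0ℤ
vsum-map-zero []       = refl
vsum-map-zero (u ∷ us) = trans (ℤ.+-identityˡ _) (vsum-map-zero us)

-- `words` lists all vertices starting with `false` before those starting with `true`; the final
-- `[]` is left by `allPairs`.
map-vertices : ∀ d (g : Vertex (suc d) → A) →
  Vec.map g (vertices (suc d)) ≡
  Vec.map (g ∘ (false ∷_)) (vertices d) ++ (Vec.map (g ∘ (true ∷_)) (vertices d) ++ [])
map-vertices {A = A} d g = begin
  Vec.map g (Vec.map _ (half false ++ (half true ++ [])))
    ≡⟨ map-∘ g _ (half false ++ (half true ++ [])) ⟨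
  Vec.map g′ (half false ++ (half true ++ []))
    ≡⟨ map-++ g′ (half false) _ ⟩
  Vec.map g′ (half false) ++ Vec.map g′ (half true ++ [])
    ≡⟨ cong (Vec.map g′ (half false) ++_) (map-++ g′ (half true) []) ⟩
  Vec.map g′ (half false) ++ (Vec.map g′ (half true) ++ [])
    ≡⟨ cong₂ (λ xs ys → xs ++ (ys ++ [])) (map-∘ g′ _ (vertices d)) (map-∘ g′ _ (vertices d)) ⟨
  Vec.map (g ∘ (false ∷_)) (vertices d) ++ (Vec.map (g ∘ (true ∷_)) (vertices d) ++ []) ∎
  where
  open ≡-Reasoning
  half : Bool → Vec (Bool × Vertex d) (2 ℕ.^ d)
  half b = Vec.map (b ,_) (vertices d)
  g′ : Bool × Vertex d → A
  g′ = g ∘ uncurry _∷_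

vertexSum : ∀ d → (Vertex d → ℤ) → ℤ
vertexSum d g = vsum (Vec.map g (vertices d))

vertexSum-suc : ∀ d g →
  vertexSum (suc d) g ≡ vertexSum d (g ∘ (false ∷_)) ℤ.+ vertexSum d (g ∘ (true ∷_))
vertexSum-suc d g = begin
  vsum (Vec.map g (vertices (suc d)))  ≡⟨ cong vsum (map-vertices d g) ⟩
  vsum (xs ++ (ys ++ []))              ≡⟨ vsum-++ xs (ys ++ []) ⟩
  vsum xs ℤ.+ vsum (ys ++ [])          ≡⟨ cong (ℤ._+_ (vsum xs)) (vsum-++ ys []) ⟩
  vsum xs ℤ.+ (vsum ys ℤ.+ 0ℤ)         ≡⟨ cong (ℤ._+_ (vsum xs)) (ℤ.+-identityʳ _) ⟩
  vsum xs ℤ.+ vsum ys                  ∎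
  where
  open ≡-Reasoning
  xs = Vec.map (g ∘ (false ∷_)) (vertices d)
  ys = Vec.map (g ∘ (true ∷_)) (vertices d)

-- Even weight characterizes the vertices of `tetrahedron`, which gives a Boolean test for
-- membership in the ground set.
even : Vertex 3 → Bool
even (a ∷ b ∷ c ∷ []) = not (a xor b xor c)

isPoint : Vertex d → Bool
isPoint (a ∷ b ∷ c ∷ u) = even (a ∷ b ∷ c ∷ []) ∧ isPoint u
isPoint (a ∷ b ∷ [])    = not a ∧ not b
isPoint (a ∷ [])        = not a
isPoint []              = true

-- Of the eight possible first blocks, four pass `even`, and they occur in the order of
-- `tetrahedron`.
vertexSum-isPoint : ∀ d g → vertexSum d (λ u → if isPoint u then g u else 0ℤ) ≡ pointSum d g
vertexSum-isPoint 0 g = ℤ.+-identityʳ _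
vertexSum-isPoint 1 g = ℤ.+-identityʳ _
vertexSum-isPoint 2 g = ℤ.+-identityʳ _
vertexSum-isPoint (suc (suc (suc d))) g = begin
  vertexSum (3 ℕ.+ d) m
    ≡⟨ split m ⟩
  octants (λ a b c → vertexSum d λ u → m (a ∷ b ∷ c ∷ u))
    ≡⟨ cong₂ ℤ._+_
         (cong₂ ℤ._+_ (pair false false) (pair false true))
         (cong₂ ℤ._+_ (pair true  false) (pair true  true)) ⟩
  octants (λ a b c → if even (a ∷ b ∷ c ∷ []) then pointSum d (λ u → g (a ∷ b ∷ c ∷ u)) else 0ℤ)
    ≡⟨ identity (slice 0F) (slice 1F) (slice 2F) (slice 3F) ⟩
  pointSum (3 ℕ.+ d) g ∎
  where
  open ≡-Reasoning
  m : Vertex (3 ℕ.+ d) → ℤ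
  m u = if isPoint u then g u else 0ℤ

  slice : Fin 4 → ℤ
  slice j = pointSum d λ u → g (lookup tetrahedron j ++ u)

  octants : (Bool → Bool → Bool → ℤ) → ℤ
  octants h = ((h false false false ℤ.+ h false false true) ℤ.+ (h false true false ℤ.+ h false true true)) ℤ.+
             ((h true  false false ℤ.+ h true  false true) ℤ.+ (h true  true false ℤ.+ h true  true true))

  split : ∀ h → vertexSum (3 ℕ.+ d) h ≡ octants (λ a b c → vertexSum d λ u → h (a ∷ b ∷ c ∷ u))
  split h = trans (vertexSum-suc (2 ℕ.+ d) h) (cong₂ ℤ._+_ (half false) (half true))
    where
    quarter : ∀ a b → _
    quarter a b = vertexSum-suc d λ u → h (a ∷ b ∷ u)
    half : ∀ a → _
    half a = trans (vertexSum-suc (1 ℕ.+ d) λ u → h (a ∷ u)) (cong₂ ℤ._+_ (quarter a false) (quarter a true))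

  block : ∀ a b c → vertexSum d (λ u → m (a ∷ b ∷ c ∷ u)) ≡
          (if even (a ∷ b ∷ c ∷ []) then pointSum d (λ u → g (a ∷ b ∷ c ∷ u)) else 0ℤ)
  -- Once the parity is known, the indicator reduces to that of the tail or to false.
  block a b c with even (a ∷ b ∷ c ∷ [])
  ... | true  = vertexSum-isPoint d λ u → g (a ∷ b ∷ c ∷ u)
  ... | false = vsum-map-zero (vertices d)

  pair : ∀ a b → _
  pair a b = cong₂ ℤ._+_ (block a b false) (block a b true)

  identity : ∀ a b c e → ((a ℤ.+ 0ℤ) ℤ.+ (0ℤ ℤ.+ b)) ℤ.+ ((0ℤ ℤ.+ c) ℤ.+ (e ℤ.+ 0ℤ)) ≡
                         a ℤ.+ (b ℤ.+ (c ℤ.+ (e ℤ.+ 0ℤ)))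
  identity = solve-∀

-- Colorings of the ground set as functions on the cube.

-- The value of xs, listed in the order of vertices d, at a vertex.
at : ∀ d → Vec A (2 ℕ.^ d) → Vertex d → A
at zero    (x ∷ []) []          = x
at (suc d) xs       (false ∷ u) = at d (Vec.take (2 ℕ.^ d) xs) u
at (suc d) xs       (true  ∷ u) = at d (Vec.take (2 ℕ.^ d) (Vec.drop (2 ℕ.^ d) xs)) u

map-at : ∀ d (xs : Vec A (2 ℕ.^ d)) → Vec.map (at d xs) (vertices d) ≡ xs
map-at zero    (x ∷ []) = refl
map-at {A = A} (suc d) xs       = begin
  Vec.map (at (suc d) xs) (vertices (suc d))
    ≡⟨ map-vertices d (at (suc d) xs) ⟩
  Vec.map (at d (Vec.take N xs)) (vertices d) ++ (Vec.map (at d (Vec.take N rest)) (vertices d) ++ [])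
    ≡⟨ cong₂ (λ ys zs → ys ++ (zs ++ [])) (map-at d _) (map-at d _) ⟩
  Vec.take N xs ++ (Vec.take N rest ++ [])
    -- `2 ^ suc d` unfolds to `N + (N + 0)`, so an empty vector remains behind the two halves.
    ≡⟨ cong (λ zs → Vec.take N xs ++ (Vec.take N rest ++ zs)) (empty (Vec.drop N rest)) ⟩
  Vec.take N xs ++ (Vec.take N rest ++ Vec.drop N rest)
    ≡⟨ cong (Vec.take N xs ++_) (take++drop≡id N rest) ⟩
  Vec.take N xs ++ rest
    ≡⟨ take++drop≡id N xs ⟩
  xs ∎
  where
  open ≡-Reasoning
  N = 2 ℕ.^ d
  rest = Vec.drop N xs
  empty : (zs : Vec A 0) → [] ≡ zs
  empty [] = refl

-- Points outside `W` get the default `Sign.+`; the mask `w u` in `sumOver-∩∣` removes them from the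
-- sums.
extend : (W : Subset n) → Coloring ∣ W ∣ → Coloring n
extend []            []      = []
extend (inside  ∷ W) (s ∷ f) = s ∷ extend W f
extend (outside ∷ W) f       = Sign.+ ∷ extend W f

-- Undoes the renumbering of a restriction. The list `us` is arbitrary and `x` is tied to the
-- coloring by an equation because the tail of `vertices d` does not list a cube.
sumOver-∩∣ : (w s : A → Bool) (us : Vec A n) (f : Coloring ∣ Vec.map w us ∣) (x : A → Sign) →
  Vec.map x us ≡ extend (Vec.map w us) f →
  sumOver (Vec.map s us ∩∣ Vec.map w us) f ≡
  vsum (Vec.map (λ u → if w u then (if s u then x u ◃ 1 else 0ℤ) else 0ℤ) us)
sumOver-∩∣ w s []       []  x eq = refl
sumOver-∩∣ w s (u ∷ us) f x eq with w u
sumOver-∩∣ w s (u ∷ us) (c ∷ f) x eq | true with refl , eq′ ← ∷-injective eq =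
  cong (ℤ._+_ (if s u then x u ◃ 1 else 0ℤ)) (sumOver-∩∣ w s us f x eq′)
sumOver-∩∣ w s (u ∷ us) f       x eq | false with _ , eq′ ← ∷-injective eq =
  trans (sumOver-∩∣ w s us f x eq′) (sym (ℤ.+-identityˡ _))

-- From imbalances to hereditary discrepancy.

points : ∀ d → Subset (2 ℕ.^ d)
points d = Vec.map isPoint (vertices d)

∈-patterns : (v : Pattern d) → v List.∈ patterns d
∈-patterns v = ∈-toList⁺ (∈-words letter v)
  where
  letter : ∀ a → a ∈ just false ∷ just true ∷ nothing ∷ []
  letter (just false) = here refl
  letter (just true)  = there (here refl)
  letter nothing      = there (there (here refl))

∈-subsets : (W : Subset n) → W List.∈ subsets n
∈-subsets W = ∈-toList⁺ (∈-words letter W)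
  where
  letter : ∀ a → a ∈ inside ∷ outside ∷ []
  letter inside  = here refl
  letter outside = there (here refl)

maxImbalance-bound : ∀ d f → let M = maxImbalance (subcubes d ∣∣ points d) f in
  8 ℕ.^ blocks d ℕ.≤ 6 ℕ.^ blocks d ℕ.* (M ℕ.* M)
maxImbalance-bound d f = imbalance-bound d x _ λ v → subst (λ s → ℤ.∣ s ∣ ℕ.≤ _) (sum≡ v)
  -- `patterns d` contains every `v`, so the imbalance of its trace is among the numbers maximized.
  (All.lookup (xs≤max 0 _) (∈-map⁺ _ (∈-map⁺ (_∩∣ points d) (∈-map⁺ subcube (∈-patterns v)))))
  where
  x : Vertex d → Sign
  x = at d (extend (points d) f)
  sum≡ : ∀ v → sumOver (subcube v ∩∣ points d) f ≡ cubeSum v (λ u → x u ◃ 1)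
  sum≡ v = trans (sumOver-∩∣ isPoint (λ u → does (u ∈S? v)) (vertices d) f x (map-at d _))
                 (vertexSum-isPoint d _)

disc-bound : ∀ d → let D = disc (subcubes d ∣∣ points d) in
  8 ℕ.^ blocks d ℕ.≤ 6 ℕ.^ blocks d ℕ.* (D ℕ.* D)
disc-bound d = argmin-all id {P = λ D → 8 ℕ.^ blocks d ℕ.≤ 6 ℕ.^ blocks d ℕ.* (D ℕ.* D)}
  (maxImbalance-bound d (Vec.replicate _ Sign.+))
  (map⁺ (All.universal (maxImbalance-bound d) (colorings ∣ points d ∣)))

herdisc-bound : ∀ d → let H = herdisc (subcubes d) in
  8 ℕ.^ blocks d ℕ.≤ 6 ℕ.^ blocks d ℕ.* (H ℕ.* H)
herdisc-bound d = ℕ.≤-trans (disc-bound d) (ℕ.*-monoʳ-≤ (6 ℕ.^ blocks d) (ℕ.*-mono-≤ D≤H D≤H))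
  where
  D≤H : disc (subcubes d ∣∣ points d) ℕ.≤ herdisc (subcubes d)
  D≤H = All.lookup (xs≤max 0 _) (∈-map⁺ _ (∈-subsets (points d)))

-- Arithmetic of the exponents.

-- A block accounts for a factor 8, and the at most two leftover coordinates for a factor of at most
-- 4.
2^d≤4*8^blocks : ∀ d → 2 ℕ.^ d ℕ.≤ 4 ℕ.* 8 ℕ.^ blocks d
2^d≤4*8^blocks 0 = ℕ.s≤s ℕ.z≤n
2^d≤4*8^blocks 1 = ℕ.s≤s (ℕ.s≤s ℕ.z≤n)
2^d≤4*8^blocks 2 = ℕ.≤-refl
2^d≤4*8^blocks (suc (suc (suc d))) = begin
  2 ℕ.^ (3 ℕ.+ d)                ≡⟨ ℕ.^-distribˡ-+-* 2 3 d ⟩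
  8 ℕ.* 2 ℕ.^ d                  ≤⟨ ℕ.*-monoʳ-≤ 8 (2^d≤4*8^blocks d) ⟩
  8 ℕ.* (4 ℕ.* 8 ℕ.^ blocks d)   ≡⟨ ℕ*.x∙yz≈y∙xz 8 4 (8 ℕ.^ blocks d) ⟩
  4 ℕ.* (8 ℕ.* 8 ℕ.^ blocks d)   ∎
  where open ℕ.≤-Reasoning

^-swap : ∀ m n o → (m ℕ.^ n) ℕ.^ o ≡ (m ℕ.^ o) ℕ.^ n
^-swap m n o = trans (ℕ.^-*-assoc m n o) (trans (cong (m ℕ.^_) (ℕ.*-comm n o)) (sym (ℕ.^-*-assoc m o n)))

-- The eighth power of the hypothesis turns `H * H` into `H ^ 16`. Eight is the least exponent for
-- which the power of 8/6 reaches 8.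
8^t≤H^16 : ∀ t H → 8 ℕ.^ t ℕ.≤ 6 ℕ.^ t ℕ.* (H ℕ.* H) → 8 ℕ.^ t ℕ.≤ H ℕ.^ 16
-- Both sides are multiplied by `(6 ^ 8) ^ t` to stay within the naturals.
8^t≤H^16 t H h = ℕ.*-cancelˡ-≤ ((6 ℕ.^ 8) ℕ.^ t) {{ℕ.m^n≢0 (6 ℕ.^ 8) t}} (begin
  (6 ℕ.^ 8) ℕ.^ t ℕ.* 8 ℕ.^ t      ≡⟨ ^-distribʳ-* (6 ℕ.^ 8) 8 t ⟨
  (6 ℕ.^ 8 ℕ.* 8) ℕ.^ t            ≤⟨ ℕ.^-monoˡ-≤ t 6^8*8≤8^8 ⟩
  (8 ℕ.^ 8) ℕ.^ t                  ≡⟨ ^-swap 8 8 t ⟩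
  (8 ℕ.^ t) ℕ.^ 8                  ≤⟨ ℕ.^-monoˡ-≤ 8 h ⟩
  (6 ℕ.^ t ℕ.* (H ℕ.* H)) ℕ.^ 8    ≡⟨ ^-distribʳ-* (6 ℕ.^ t) (H ℕ.* H) 8 ⟩
  (6 ℕ.^ t) ℕ.^ 8 ℕ.* (H ℕ.* H) ℕ.^ 8
    ≡⟨ cong₂ ℕ._*_ (^-swap 6 t 8) (trans (^-distribʳ-* H H 8) (sym (ℕ.^-distribˡ-+-* H 8 8))) ⟩
  (6 ℕ.^ 8) ℕ.^ t ℕ.* H ℕ.^ 16     ∎)
  where
  open ℕ.≤-Reasoning
  6^8*8≤8^8 : 6 ℕ.^ 8 ℕ.* 8 ℕ.≤ 8 ℕ.^ 8
  6^8*8≤8^8 = toWitness {a? = _ ℕ.≤? _} tt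

-- Passage to rational numbers.

-- Unnormalised fractions keep the denominator 1 visible, so order and products can be read off the
-- numerators.
toℚᵘ-fromℕ : ∀ n → toℚᵘ (fromℕ n) ℚᵘ.≃ ℚᵘ.mkℚᵘ (+ n) 0
toℚᵘ-fromℕ n = ℚ.toℚᵘ-fromℚᵘ (ℚᵘ.mkℚᵘ (+ n) 0)

fromℕ-mono-≤ : ∀ {m n} → m ℕ.≤ n → fromℕ m ℚ.≤ fromℕ n
fromℕ-mono-≤ {m} {n} m≤n = ℚ.toℚᵘ-cancel-≤ (begin
  toℚᵘ (fromℕ m)      ≃⟨ toℚᵘ-fromℕ m ⟩
  ℚᵘ.mkℚᵘ (+ m) 0     ≤⟨ ℚᵘ.*≤* (ℤ.*-monoʳ-≤-nonNeg (+ 1) (ℤ.+≤+ m≤n)) ⟩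
  ℚᵘ.mkℚᵘ (+ n) 0     ≃⟨ toℚᵘ-fromℕ n ⟨
  toℚᵘ (fromℕ n)      ∎)
  where open ℚᵘ.≤-Reasoning

fromℕ-* : ∀ m n → fromℕ (m ℕ.* n) ≡ fromℕ m * fromℕ n
fromℕ-* m n = ℚ.toℚᵘ-injective (begin-equality
  toℚᵘ (fromℕ (m ℕ.* n))                   ≃⟨ toℚᵘ-fromℕ (m ℕ.* n) ⟩
  ℚᵘ.mkℚᵘ (+ (m ℕ.* n)) 0                  ≡⟨ cong (λ i → ℚᵘ.mkℚᵘ i 0) (ℤ.pos-* m n) ⟩
  ℚᵘ.mkℚᵘ (+ m) 0 ℚᵘ.* ℚᵘ.mkℚᵘ (+ n) 0     ≃⟨ ℚᵘ.*-cong (toℚᵘ-fromℕ m) (toℚᵘ-fromℕ n) ⟨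
  toℚᵘ (fromℕ m) ℚᵘ.* toℚᵘ (fromℕ n)       ≃⟨ ℚ.toℚᵘ-homo-* (fromℕ m) (fromℕ n) ⟨
  toℚᵘ (fromℕ m * fromℕ n)                 ∎)
  where open ℚᵘ.≤-Reasoning

fromℕ-^ : ∀ m n → fromℕ (m ℕ.^ n) ≡ fromℕ m ^ n
fromℕ-^ m zero    = refl
fromℕ-^ m (suc n) = trans (fromℕ-* m (m ℕ.^ n)) (cong (fromℕ m *_) (fromℕ-^ m n))

-- The constant 1/2 absorbs the factor 4 lost to padding, since its sixteenth power is far below
-- 1/4.
scale : ∀ m n → m ℕ.≤ 4 ℕ.* n → ½ ^ 16 * fromℕ m ℚ.≤ fromℕ n
scale m n m≤4n = begin
  ½ ^ 16 * fromℕ m              ≤⟨ ℚ.*-monoˡ-≤-nonNeg (½ ^ 16) (fromℕ-mono-≤ m≤4n) ⟩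
  ½ ^ 16 * fromℕ (4 ℕ.* n)      ≡⟨ cong (½ ^ 16 *_) (fromℕ-* 4 n) ⟩
  ½ ^ 16 * (fromℕ 4 * fromℕ n)  ≡⟨ ℚ.*-assoc (½ ^ 16) (fromℕ 4) (fromℕ n) ⟨
  ½ ^ 16 * fromℕ 4 * fromℕ n    ≤⟨ ℚ.*-monoʳ-≤-nonNeg (fromℕ n) {{ℚ.normalize-nonNeg n 1}} ½^16*4≤1 ⟩
  1ℚ * fromℕ n                  ≡⟨ ℚ.*-identityˡ (fromℕ n) ⟩
  fromℕ n                       ∎
  where
  open ℚ.≤-Reasoning
  ½^16*4≤1 : ½ ^ 16 * fromℕ 4 ℚ.≤ 1ℚ
  ½^16*4≤1 = toWitness {a? = _ ℚ.≤? _} tt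

-- Both sides of the inequality are nonnegative, so taking sixteenth powers gives an equivalent form
-- without the irrational values of `2^(d/16)`.
lemma3p1 : ∃ λ (c : ℚ) → Positive c × (∀ (d : ℕ) → .{{_ : NonZero d}} →
    fromℕ (herdisc (subcubes d)) ^ 16 ≥ (c ^ 16) * fromℕ (2 ℕ.^ d))
lemma3p1 = ½ , _ , λ d → let H = herdisc (subcubes d) in
  subst (½ ^ 16 * fromℕ (2 ℕ.^ d) ℚ.≤_) (fromℕ-^ H 16)
    (scale (2 ℕ.^ d) (H ℕ.^ 16) (ℕ.≤-trans (2^d≤4*8^blocks d)
      (ℕ.*-monoʳ-≤ 4 (8^t≤H^16 (blocks d) H (herdisc-bound d)))))
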